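{- Let $p$ be an odd prime, let $v$ be an integer with $1<v<p-1$, and let $g\in\{2,\dots,p-1\}$ be a primitive root modulo $p$. Define the sequence $\gamma_v=(\gamma_v(i))_{i=1}^{p-1}$ by $\gamma_v(i)=\big(g^{i-1}\,\%\,p\big)\,\%\,v$. Then $\gamma_v$, regarded as a periodic sequence of length $p-1$, has least period exactly $p-1$.
   Context: For integers $x$ and $m\ge 1$, $x\,\%\,m$ denotes the least nonnegative remainder of $x$ upon division by $m$ (so $g^{i-1}\,\%\,p\in\{1,\dots,p-1\}$ is read as an ordinary integer before reducing modulo $v$). A sequence $s$ of length $N$ is regarded as indexed cyclically (indices modulo $N$); its least period is the smallest integer $\rho>0$ with $s(i+\rho)=s(i)$ for all indices $i$ (indices taken modulo $N$). -}

module Defs where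

open import Data.Fin using (Fin; toℕ)
open import Data.Fin.Properties using (nonZeroIndex)
open import Data.Nat using (ℕ; _+_; _∸_; _^_; _≤_; _<_; NonZero)
open import Data.Nat.Coprimality using (Coprime)
open import Data.Nat.DivMod using (_%_; _mod_)
open import Data.Product using (_×_; ∃-syntax)
open import Data.Vec.Functional using (Vector)
open import Relation.Binary.PropositionalEquality using (_≡_)

-- g is a unit modulo n and its powers run through all units modulo n.
IsPrimitiveRoot : (n : ℕ) .{{_ : NonZero n}} → ℕ → Set
IsPrimitiveRoot n g =
  Coprime g n × (∀ a → Coprime a n → ∃[ k ] (g ^ k) % n ≡ a % n)

-- An index exists only when N is nonzero, so N itself may be arbitrary.
shift : ∀ {N} → ℕ → Fin N → Fin N
shift {N} ρ i = (toℕ i + ρ) mod N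
  where instance
    N≢0 : NonZero N
    N≢0 = nonZeroIndex i

HasPeriod : ∀ {a} {A : Set a} {N} → Vector A N → ℕ → Set a
HasPeriod s ρ = ∀ i → s (shift ρ i) ≡ s i

IsLeastPeriod : ∀ {a} {A : Set a} {N} → Vector A N → ℕ → Set a
IsLeastPeriod s ρ =
  0 < ρ × HasPeriod s ρ × (∀ σ → 0 < σ → HasPeriod s σ → ρ ≤ σ)

-- Fin counts from 0, so the index j stands for the position i = j + 1 and the
-- exponent i - 1 is toℕ j.
γ : (p g v : ℕ) .{{_ : NonZero p}} .{{_ : NonZero v}} → Vector ℕ (p ∸ 1)
γ p g v j = ((g ^ toℕ j) % p) % v

{-# OPTIONS --safe #-}

-- Suppose σ is a period with multiplier h = g ^ σ % p. Since the powers of g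
-- exhaust the nonzero residues, (x * h) % p ≡ x modulo v for all 0 < x < p; in
-- particular (x = 1) h ≡ 1 modulo v. If h were at least 2, let x = 1 + p / h be
-- the first factor for which x * h exceeds p: then x * h and x * h - p are
-- both ≡ x modulo v, so v divides the prime p, which is absurd. Hence
-- g ^ σ ≡ 1 modulo p, and σ is at least the number p - 1 of distinct powers of g.
module Submission where

open import Defs
open import Data.Fin as Fin using (Fin; toℕ; punchOut)
open import Data.Fin.Properties
  using (toℕ<n; toℕ-fromℕ<; toℕ-injective; nonZeroIndex; pigeonhole; injective⇒≤; punchOut-injective)
open import Data.Nat
  using (ℕ; zero; suc; _+_; _*_; _∸_; _^_; _≤_; _<_; NonZero; >-nonZero; z<s; s<s; z≤n; s≤s; s≤s⁻¹; s<s⁻¹)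
open import Data.Nat.Coprimality as Coprimality using (Coprime; prime⇒coprime)
open import Data.Nat.DivMod
open import Data.Nat.Divisibility
  using (_∣_; _∤_; m%n≡0⇒n∣m; n∣m*n; ∣m+n∣m⇒∣n; ∣-trans; 1∣_; >⇒∤)
open import Data.Nat.Primality using (Prime; euclidsLemma; prime⇒irreducible)
open import Data.Nat.Properties
open import Data.Product using (_×_; _,_; proj₁; proj₂; ∃-syntax)
open import Data.Sum using ([_,_]′)
open import Function using (id)
open import Relation.Binary.PropositionalEquality
open import Relation.Nullary using (contradiction)

open ≡-Reasoning

toℕ-mod : ∀ m d .{{_ : NonZero d}} → toℕ (m mod d) ≡ m % d
toℕ-mod m d = toℕ-fromℕ< (m%n<n m d)

toℕ-shift : ∀ {N} .{{_ : NonZero N}} σ (i : Fin N) → toℕ (shift σ i) ≡ (toℕ i + σ) % N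
toℕ-shift {N} σ i = toℕ-mod (toℕ i + σ) N {{nonZeroIndex i}}

-- Cancelling the common remainder leaves `n` as the difference of two multiples of `d`.
[m+n]%d≡m%d⇒d∣n : ∀ m n d .{{_ : NonZero d}} → (m + n) % d ≡ m % d → d ∣ n
[m+n]%d≡m%d⇒d∣n m n d eq =
  ∣m+n∣m⇒∣n (subst (d ∣_) (sym quotients) (n∣m*n ((m + n) / d))) (n∣m*n (m / d))
  where
  quotients : m / d * d + n ≡ (m + n) / d * d
  quotients = +-cancelˡ-≡ (m % d) _ _ (begin
    m % d + (m / d * d + n)           ≡⟨ +-assoc (m % d) _ n ⟨
    m % d + m / d * d + n             ≡⟨ cong (_+ n) (m≡m%n+[m/n]*n m d) ⟨
    m + n                             ≡⟨ m≡m%n+[m/n]*n (m + n) d ⟩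
    (m + n) % d + (m + n) / d * d     ≡⟨ cong (_+ (m + n) / d * d) eq ⟩
    m % d + (m + n) / d * d           ∎)

%-cong-* : ∀ {a b c e} n .{{_ : NonZero n}} →
  a % n ≡ b % n → c % n ≡ e % n → (a * c) % n ≡ (b * e) % n
%-cong-* {a} {b} {c} {e} n a≡b c≡e = begin
  (a * c) % n               ≡⟨ %-distribˡ-* a c n ⟩
  ((a % n) * (c % n)) % n   ≡⟨ cong₂ (λ x y → (x * y) % n) a≡b c≡e ⟩
  ((b % n) * (e % n)) % n   ≡⟨ %-distribˡ-* b e n ⟨
  (b * e) % n               ∎

%-cong-^ : ∀ {a b} n .{{_ : NonZero n}} k → a % n ≡ b % n → (a ^ k) % n ≡ (b ^ k) % n
%-cong-^ n zero    a≡b = refl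
%-cong-^ n (suc k) a≡b = %-cong-* n a≡b (%-cong-^ n k a≡b)

-- Splitting `k` as `k % d + k / d * d`, the second part contributes a power of `g ^ d`, hence 1.
-- Here `d` may be any exponent sending `g` to 1, not only the order of `g`.
^-%-reduce : ∀ g n d .{{_ : NonZero n}} .{{_ : NonZero d}} →
  (g ^ d) % n ≡ 1 % n → ∀ k → (g ^ (k % d)) % n ≡ (g ^ k) % n
^-%-reduce g n d g^d≡1 k = sym (begin
  (g ^ k) % n                              ≡⟨ cong (λ j → (g ^ j) % n) (m≡m%n+[m/n]*n k d) ⟩
  (g ^ (k % d + k / d * d)) % n            ≡⟨ cong (_% n) (^-distribˡ-+-* g (k % d) _) ⟩
  (g ^ (k % d) * g ^ (k / d * d)) % n      ≡⟨ %-cong-* {g ^ (k % d)} n refl multiple≡1 ⟩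
  (g ^ (k % d) * 1) % n                    ≡⟨ cong (_% n) (*-identityʳ _) ⟩
  (g ^ (k % d)) % n                        ∎)
  where
  multiple≡1 : (g ^ (k / d * d)) % n ≡ 1 % n
  multiple≡1 = begin
    (g ^ (k / d * d)) % n     ≡⟨ cong (λ j → (g ^ j) % n) (*-comm (k / d) d) ⟩
    (g ^ (d * (k / d))) % n   ≡⟨ cong (_% n) (^-*-assoc g d (k / d)) ⟨
    ((g ^ d) ^ (k / d)) % n   ≡⟨ %-cong-^ n (k / d) g^d≡1 ⟩
    (1 ^ (k / d)) % n         ≡⟨ cong (_% n) (^-zeroˡ (k / d)) ⟩
    1 % n                     ∎

prime∤^ : ∀ {p g} → Prime p → p ∤ g → ∀ k → p ∤ g ^ k
prime∤^ {g = g} pr p∤g zero p∣1 = p∤g (∣-trans p∣1 (1∣ g))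
prime∤^ pr p∤g (suc k) p∣g^1+k =
  [ p∤g , prime∤^ pr p∤g k ]′ (euclidsLemma _ _ pr p∣g^1+k)

multiplier≡1 : ∀ {p v h} .{{_ : NonZero p}} .{{_ : NonZero v}} →
  Prime p → 1 < v → v < p → 0 < h → h < p →
  (∀ x → 0 < x → x < p → ((x * h) % p) % v ≡ x % v) → h ≡ 1
multiplier≡1 {h = 1} _ _ _ _ _ _ = refl
multiplier≡1 {p} {v} {h@(suc (suc h-2))} pr 1<v v<p _ h<p agree =
  contradiction (prime⇒irreducible pr v∣p) [ (λ v≡1 → <⇒≢ 1<v (sym v≡1)) , <⇒≢ v<p ]′
  where
  q x w : ℕ
  q = p / h
  x = suc q
  -- The overshoot of `x * h` beyond `p`. It is at most `h`, hence below `p`, and so it is the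
  -- remainder of `x * h` modulo `p`.
  w = h ∸ p % h

  q*2≤p : q * 2 ≤ p
  q*2≤p = ≤-trans (*-monoʳ-≤ q (s≤s (s≤s z≤n))) (m/n*n≤m p h)

  x<p : x < p
  -- As `h` is at least 2, `q + q ≤ p`. If also `p ≤ 1 + q`, then `q ≤ 1` and `p ≤ 2`, against
  -- `1 < v < p`.
  x<p = ≰⇒> λ p≤x →
    let q≤1 : q ≤ 1
        q≤1 = +-cancelˡ-≤ q q 1 (subst₂ _≤_ (trans (*-comm q 2) (cong (q +_) (+-identityʳ q)))
                (+-comm 1 q) (≤-trans q*2≤p p≤x))
    in <⇒≱ (≤-<-trans 1<v v<p) (≤-trans p≤x (s≤s q≤1))

  x*h≡w+p : x * h ≡ w + p
  x*h≡w+p = begin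
    h + q * h                 ≡⟨ cong (_+ q * h) (m∸n+n≡m (m%n≤n p h)) ⟨
    w + p % h + q * h         ≡⟨ +-assoc w (p % h) (q * h) ⟩
    w + (p % h + q * h)       ≡⟨ cong (w +_) (m≡m%n+[m/n]*n p h) ⟨
    w + p                     ∎

  [x*h]%p≡w : (x * h) % p ≡ w
  [x*h]%p≡w = begin
    (x * h) % p   ≡⟨ cong (_% p) x*h≡w+p ⟩
    (w + p) % p   ≡⟨ [m+n]%n≡m%n w p ⟩
    w % p         ≡⟨ m<n⇒m%n≡m (≤-<-trans (m∸n≤m h (p % h)) h<p) ⟩
    w             ∎

  h%v≡1%v : h % v ≡ 1 % v
  h%v≡1%v = begin
    h % v               ≡⟨ cong (_% v) (m<n⇒m%n≡m h<p) ⟨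
    (h % p) % v         ≡⟨ cong (λ y → (y % p) % v) (*-identityˡ h) ⟨
    ((1 * h) % p) % v   ≡⟨ agree 1 z<s (<-trans 1<v v<p) ⟩
    1 % v               ∎

  v∣p : v ∣ p
  v∣p = [m+n]%d≡m%d⇒d∣n w p v (begin
    (w + p) % v         ≡⟨ cong (_% v) x*h≡w+p ⟨
    (x * h) % v         ≡⟨ %-cong-* {x} v refl h%v≡1%v ⟩
    (x * 1) % v         ≡⟨ cong (_% v) (*-identityʳ x) ⟩
    x % v               ≡⟨ agree x z<s x<p ⟨
    ((x * h) % p) % v   ≡⟨ cong (_% v) [x*h]%p≡w ⟩
    w % v               ∎)

-- With the prime written as `suc n`, the length `p ∸ 1` of the sequence computes to `n`.
module _ {n g : ℕ} (pr : Prime (suc n)) (1<p : 1 < suc n) (p∤g : suc n ∤ g) where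

  private
    p : ℕ
    p = suc n

  <⇒coprime : ∀ {a} → 0 < a → a < p → Coprime a p
  <⇒coprime 0<a a<p = Coprimality.sym (prime⇒coprime pr {{>-nonZero 0<a}} a<p)

  0<g^k%p : ∀ k → 0 < (g ^ k) % p
  0<g^k%p k = n≢0⇒n>0 λ eq → prime∤^ pr p∤g k (m%n≡0⇒n∣m (g ^ k) p eq)

  -- The hypothesis says that `p` divides `g ^ i * (g ^ d ∸ 1)`; by Euclid's lemma it divides the
  -- second factor, since it divides no power of `g`.
  ^-%-cancel : ∀ i d → (g ^ (i + d)) % p ≡ (g ^ i) % p → (g ^ d) % p ≡ 1
  ^-%-cancel i d eq = begin
    (g ^ d) % p                     ≡⟨ cong (_% p) (m+[n∸m]≡n 1≤g^d) ⟨
    (1 + (g ^ d ∸ 1)) % p           ≡⟨ %-remove-+ʳ 1 p∣g^d∸1 ⟩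
    1 % p                           ≡⟨ m<n⇒m%n≡m 1<p ⟩
    1                               ∎
    where
    -- This makes the truncated subtraction `g ^ d ∸ 1` exact.
    1≤g^d : 1 ≤ g ^ d
    1≤g^d = ≤-trans (0<g^k%p d) (m%n≤m (g ^ d) p)

    p∣g^i*[g^d∸1] : p ∣ g ^ i * (g ^ d ∸ 1)
    p∣g^i*[g^d∸1] = [m+n]%d≡m%d⇒d∣n (g ^ i) _ p (begin
      (g ^ i + g ^ i * (g ^ d ∸ 1)) % p   ≡⟨ cong (_% p) (*-suc (g ^ i) _) ⟨
      (g ^ i * (1 + (g ^ d ∸ 1))) % p     ≡⟨ cong (λ y → (g ^ i * y) % p) (m+[n∸m]≡n 1≤g^d) ⟩
      (g ^ i * g ^ d) % p                 ≡⟨ cong (_% p) (^-distribˡ-+-* g i d) ⟨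
      (g ^ (i + d)) % p                   ≡⟨ eq ⟩
      (g ^ i) % p                         ∎)

    p∣g^d∸1 : p ∣ g ^ d ∸ 1
    p∣g^d∸1 = [ (λ p∣g^i → contradiction p∣g^i (prime∤^ pr p∤g i)) , id ]′
                (euclidsLemma (g ^ i) _ pr p∣g^i*[g^d∸1])

  -- The p powers g ^ 0, …, g ^ n take at most n nonzero residues.
  ∃-exponent : ∃[ d ] 0 < d × d ≤ n × (g ^ d) % p ≡ 1
  ∃-exponent =
    let i , j , i<j , same = pigeonhole (n<1+n n) (λ k → punchOut (zero≢power k))
        d = toℕ j ∸ toℕ i
    in d , m<n⇒0<n∸m i<j , ≤-trans (m∸n≤m (toℕ j) (toℕ i)) (s≤s⁻¹ (toℕ<n j)) ,
       ^-%-cancel (toℕ i) d (begin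
         (g ^ (toℕ i + d)) % p     ≡⟨ cong (λ k → (g ^ k) % p) (m+[n∸m]≡n (<⇒≤ i<j)) ⟩
         (g ^ toℕ j) % p           ≡⟨ toℕ-mod (g ^ toℕ j) p ⟨
         toℕ (g ^ toℕ j mod p)     ≡⟨ cong toℕ (punchOut-injective (zero≢power i) (zero≢power j) same) ⟨
         toℕ (g ^ toℕ i mod p)     ≡⟨ toℕ-mod (g ^ toℕ i) p ⟩
         (g ^ toℕ i) % p           ∎)
    where
    zero≢power : (k : Fin p) → Fin.zero ≢ g ^ toℕ k mod p
    zero≢power k eq = <⇒≢ (0<g^k%p (toℕ k)) (trans (cong toℕ eq) (toℕ-mod (g ^ toℕ k) p))

  module _ (primitiveRoot : IsPrimitiveRoot p g) where

    logarithm : ∀ {x} → 0 < x → x < p → ∃[ k ] (g ^ k) % p ≡ x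
    logarithm 0<x x<p =
      let k , g^k≡x = proj₂ primitiveRoot _ (<⇒coprime 0<x x<p)
      in k , trans g^k≡x (m<n⇒m%n≡m x<p)

    -- If `g ^ d` is 1 modulo `p`, a logarithm still recovers its residue after reduction modulo
    -- `d`. Hence the `n` nonzero residues have distinct logarithms among `d` values.
    n≤exponent : ∀ d → 0 < d → (g ^ d) % p ≡ 1 → n ≤ d
    n≤exponent d 0<d g^d≡1 = injective⇒≤ {f = reducedLog} λ {a} {b} eq →
      toℕ-injective (suc-injective (begin
        suc (toℕ a)                   ≡⟨ ^-reducedLog a ⟨
        (g ^ toℕ (reducedLog a)) % p  ≡⟨ cong (λ k → (g ^ toℕ k) % p) eq ⟩
        (g ^ toℕ (reducedLog b)) % p  ≡⟨ ^-reducedLog b ⟩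
        suc (toℕ b)                   ∎))
      where
      instance
        d≢0 : NonZero d
        d≢0 = >-nonZero 0<d

      -- The index `a` stands for the nonzero residue `a + 1`.
      log : (a : Fin n) → ∃[ k ] (g ^ k) % p ≡ suc (toℕ a)
      log a = logarithm z<s (s<s (toℕ<n a))

      reducedLog : Fin n → Fin d
      reducedLog a = proj₁ (log a) mod d

      ^-reducedLog : ∀ a → (g ^ toℕ (reducedLog a)) % p ≡ suc (toℕ a)
      ^-reducedLog a = begin
        (g ^ toℕ (reducedLog a)) % p       ≡⟨ cong (λ k → (g ^ k) % p) (toℕ-mod _ d) ⟩
        (g ^ (proj₁ (log a) % d)) % p      ≡⟨ ^-%-reduce g p d (trans g^d≡1 (sym (m<n⇒m%n≡m 1<p))) _ ⟩
        (g ^ proj₁ (log a)) % p            ≡⟨ proj₂ (log a) ⟩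
        suc (toℕ a)                        ∎

    -- The pigeonhole principle yields an exponent `d ≤ n`, and surjectivity onto the nonzero
    -- residues forces `n ≤ d`, so `d` is `n` itself.
    fermat : (g ^ n) % p ≡ 1
    fermat =
      let d , 0<d , d≤n , g^d≡1 = ∃-exponent
      in subst (λ k → (g ^ k) % p ≡ 1) (≤-antisym d≤n (n≤exponent d 0<d g^d≡1)) g^d≡1

    -- Every nonzero residue `x` occurs as a power `g ^ i` with `i` an index of the sequence, and
    -- moving `σ` places on from `i` multiplies that residue by `g ^ σ`.
    γ-period⇒multiplier : ∀ {v} .{{_ : NonZero v}} σ → HasPeriod (γ p g v) σ →
      ∀ x → 0 < x → x < p → ((x * ((g ^ σ) % p)) % p) % v ≡ x % v
    γ-period⇒multiplier {v} σ periodic x 0<x x<p = begin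
      ((x * ((g ^ σ) % p)) % p) % v           ≡⟨ cong (_% v) (%-cong-* {x} {g ^ toℕ i} {(g ^ σ) % p} {g ^ σ} p x≡g^i (m%n%n≡m%n (g ^ σ) p)) ⟩
      ((g ^ toℕ i * g ^ σ) % p) % v           ≡⟨ cong (λ y → (y % p) % v) (^-distribˡ-+-* g (toℕ i) σ) ⟨
      -- The cyclic shift wraps exponents modulo `n`, which by `fermat` leaves the residue modulo
      -- `p` unchanged.
      ((g ^ (toℕ i + σ)) % p) % v             ≡⟨ cong (_% v) (reduce (toℕ i + σ)) ⟨
      ((g ^ ((toℕ i + σ) % n)) % p) % v       ≡⟨ cong (λ j → ((g ^ j) % p) % v) (toℕ-shift σ i) ⟨
      γ p g v (shift σ i)                     ≡⟨ periodic i ⟩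
      ((g ^ toℕ i) % p) % v                   ≡⟨ cong (_% v) g^i≡x ⟩
      x % v                                   ∎
      where
      instance
        n≢0 : NonZero n
        n≢0 = >-nonZero (s<s⁻¹ 1<p)

      reduce : ∀ k → (g ^ (k % n)) % p ≡ (g ^ k) % p
      reduce = ^-%-reduce g p n (trans fermat (sym (m<n⇒m%n≡m 1<p)))

      i : Fin n
      i = proj₁ (logarithm 0<x x<p) mod n

      g^i≡x : (g ^ toℕ i) % p ≡ x
      g^i≡x = begin
        (g ^ toℕ i) % p                                ≡⟨ cong (λ k → (g ^ k) % p) (toℕ-mod _ n) ⟩
        (g ^ (proj₁ (logarithm 0<x x<p) % n)) % p      ≡⟨ reduce _ ⟩
        (g ^ proj₁ (logarithm 0<x x<p)) % p            ≡⟨ proj₂ (logarithm 0<x x<p) ⟩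
        x                                              ∎

      x≡g^i : x % p ≡ (g ^ toℕ i) % p
      x≡g^i = trans (m<n⇒m%n≡m x<p) (sym g^i≡x)

shift-N : ∀ {N} (i : Fin N) → shift N i ≡ i
shift-N {N} i = toℕ-injective (begin
  toℕ (shift N i)     ≡⟨ toℕ-shift N i ⟩
  (toℕ i + N) % N     ≡⟨ [m+n]%n≡m%n (toℕ i) N ⟩
  toℕ i % N           ≡⟨ m<n⇒m%n≡m (toℕ<n i) ⟩
  toℕ i               ∎)
  where
  instance
    N≢0 : NonZero N
    N≢0 = nonZeroIndex i

theorem7 : (p v g : ℕ) .{{_ : NonZero p}} .{{_ : NonZero v}} →
    Prime p → 2 ∤ p →
    1 < v → v < p ∸ 1 →
    2 ≤ g → g ≤ p ∸ 1 → IsPrimitiveRoot p g →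
    IsLeastPeriod (γ p g v) (p ∸ 1)
theorem7 p@(suc n) v g pr _ 1<v v<n 2≤g g≤n primitiveRoot =
  <-trans z<s (<-trans 1<v v<n) ,
  (λ i → cong (γ p g v) (shift-N i)) ,
  λ σ 0<σ periodic → n≤exponent pr 1<p p∤g primitiveRoot σ 0<σ
    (multiplier≡1 pr 1<v v<p (0<g^k%p pr 1<p p∤g σ) (m%n<n (g ^ σ) p)
      (γ-period⇒multiplier pr 1<p p∤g primitiveRoot σ periodic))
  where
  v<p : v < p
  v<p = m<n⇒m<1+n v<n

  1<p : 1 < p
  1<p = <-trans 1<v v<p

  p∤g : p ∤ g
  p∤g = >⇒∤ {{>-nonZero (<-trans z<s 2≤g)}} (s≤s g≤n)
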